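{- Let $p$ be an odd prime, let $v_2(p-1)=\lambda$ and $\max\{v_2(p-1), v_2(p+1)\}=\mu$, and let $\phi(z)=z^2$. Then $$\lim_{\substack{n \to \infty\\ v_2(n)=0}}\frac{\#\operatorname{Per}\left(\phi, \mathbb{F}_{p^n}\right)}{p^n} = \frac{1}{2^\lambda},$$ and for every integer $\nu\geq 1$, $$\lim_{\substack{n \to \infty\\ v_2(n)=\nu}}\frac{\#\operatorname{Per}\left(\phi, \mathbb{F}_{p^n}\right)}{p^n} = \frac{1}{2^{\mu+\nu}}.$$
   Context: For a polynomial $\phi$ with integer coefficients (reduced mod $p$) and a field $K$ of characteristic $p$, $\operatorname{Per}(\phi,K)=\{\alpha\in K : \phi^m(\alpha)=\alpha \text{ for some } m>0\}$, where $\phi^m$ is the $m$-th iterate of $\phi$ under composition. $\mathbb{F}_{p^n}$ is the field with $p^n$ elements. $v_2$ is the $2$-adic valuation. The limits are taken as $n\to\infty$ through the positive integers $n$ satisfying the condition displayed under the limit sign. -}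

module Defs where

open import Algebra.Bundles using (CommutativeRing)
open import Data.Fin.Base using (Fin; toℕ; fromℕ<)
open import Data.Fin.Properties as FinP
  using (any?; pigeonhole; nonZeroIndex; toℕ-fromℕ<; toℕ<n)
open import Data.Integer.Base as ℤ using (ℤ; +_; -[1+_])
open import Data.List.Base using (List; []; _∷_; allFin; filter; length; map)
open import Data.Nat.Base as ℕ using (ℕ; zero; suc; NonZero; _^_; s≤s)
open import Data.Nat.Divisibility using (_∣?_)
open import Data.Nat.GeneralisedArithmetic using (fold; fold-+)
import Data.Nat.Properties as ℕ
open import Data.Product.Base using (_×_; _,_; ∃-syntax)
open import Data.Rational.Base as ℚ using (ℚ; 0ℚ)
open import Function.Bundles using (Inverse)
open import Level using (Level; _⊔_) renaming (suc to lsuc)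
open import Relation.Binary.Definitions using (Decidable)
open import Relation.Binary.PropositionalEquality as ≡ using (_≡_)
import Relation.Binary.Reasoning.Setoid as SetoidReasoning
open import Relation.Nullary.Decidable using (Dec; map′; yes; no)
open import Relation.Nullary.Negation using (¬_)

private
  variable
    c ℓ : Level
    q : ℕ

------------------------------------------------------------------------
-- The 2-adic valuation

-- maxPow2 n k is the largest j ≤ k with 2 ^ j ∣ n.
maxPow2 : ℕ → ℕ → ℕ
maxPow2 n zero    = 0
maxPow2 n (suc k) with 2 ^ suc k ∣? n
... | yes _ = suc k
... | no  _ = maxPow2 n k

-- For n > 0, 2 ^ j ∣ n forces j < n, so the bound n on the exponent loses
-- nothing.  The value v₂ 0 = 0 is junk.
v₂ : ℕ → ℕ
v₂ n = maxPow2 n n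

------------------------------------------------------------------------
-- Limits

infix 8 1/2^_
1/2^_ : ℕ → ℚ
1/2^ k = ((+ 1) ℚ./ (2 ^ k)) {{ℕ.m^n≢0 2 k}}

-- a n tends to L as n → ∞ through the positive integers satisfying P.
-- As a n and L are rational, testing against rational ε is enough.
LimitAlong : (P : ℕ → Set) → ((n : ℕ) → .{{NonZero n}} → ℚ) → ℚ → Set
LimitAlong P a L =
  ∀ (ε : ℚ) → 0ℚ ℚ.< ε →
  ∃[ N ] (∀ (n : ℕ) → .{{_ : NonZero n}} → N ℕ.≤ n → P n →
          ℚ.∣ a n ℚ.- L ∣ ℚ.< ε)

------------------------------------------------------------------------
-- Fields with q elements

record FiniteField (c ℓ : Level) (q : ℕ) : Set (lsuc (c ⊔ ℓ)) where
  field
    commutativeRing : CommutativeRing c ℓ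

  open CommutativeRing commutativeRing public

  field
    0≉1     : ¬ 0# ≈ 1#
    inverse : ∀ x → ¬ x ≈ 0# → ∃[ y ] x * y ≈ 1#
    -- A bijection between the carrier, taken up to _≈_, and Fin q.
    index   : Inverse setoid (≡.setoid (Fin q))

  open Inverse index public
    using () renaming (to to toFin; from to fromFin; to-cong to toFin-cong)

  toFin-injective : ∀ {x y} → toFin x ≡ toFin y → x ≈ y
  toFin-injective {x} {y} eq =
    trans (sym (Inverse.strictlyInverseʳ index x))
          (Inverse.inverseʳ index eq)

  infix 4 _≟_
  _≟_ : Decidable _≈_
  x ≟ y = map′ toFin-injective toFin-cong (toFin x FinP.≟ toFin y)

  elements : List Carrier
  elements = map fromFin (allFin q)

------------------------------------------------------------------------
-- Integer polynomials acting on a finite field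

-- Coefficients, constant term first.
ℤ[z] : Set
ℤ[z] = List ℤ

z² : ℤ[z]
z² = + 0 ∷ + 0 ∷ + 1 ∷ []

module _ (K : FiniteField c ℓ q) where
  open FiniteField K
  open import Algebra.Definitions.RawMonoid +-rawMonoid
    using () renaming (_×_ to _·_)

  fromℤ : ℤ → Carrier
  fromℤ (+ n)    = n · 1#
  fromℤ -[1+ n ] = - (suc n · 1#)

  eval : ℤ[z] → Carrier → Carrier
  eval []      x = 0#
  eval (a ∷ φ) x = fromℤ a + x * eval φ x

  iter : ℤ[z] → ℕ → Carrier → Carrier
  iter φ m x = fold x (eval φ) m

  -- Membership in Per(φ, K).
  IsPeriodic : ℤ[z] → Carrier → Set ℓ
  IsPeriodic φ α = ∃[ m ] (0 ℕ.< m × iter φ m α ≈ α)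

  -- Periodicity is decidable because, by the pigeonhole principle, a periodic
  -- point has a period that is at most q.
  module _ (φ : ℤ[z]) where
    open SetoidReasoning setoid

    eval-cong : ∀ ψ {x y} → x ≈ y → eval ψ x ≈ eval ψ y
    eval-cong []      x≈y = refl
    eval-cong (a ∷ ψ) x≈y = +-congˡ (*-cong x≈y (eval-cong ψ x≈y))

    iter-cong : ∀ m {x y} → x ≈ y → iter φ m x ≈ iter φ m y
    iter-cong zero    x≈y = x≈y
    iter-cong (suc m) x≈y = eval-cong φ (iter-cong m x≈y)

    iter-+ : ∀ m n x → iter φ (m ℕ.+ n) x ≈ iter φ m (iter φ n x)
    iter-+ m n x = reflexive (fold-+ x (eval φ) m)

    iter-multiple : ∀ k m {α} → iter φ m α ≈ α → iter φ (k ℕ.* m) α ≈ α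
    iter-multiple zero    m     eq = refl
    iter-multiple (suc k) m {α} eq = begin
      iter φ (m ℕ.+ k ℕ.* m) α      ≈⟨ iter-+ m (k ℕ.* m) α ⟩
      iter φ m (iter φ (k ℕ.* m) α) ≈⟨ iter-cong m (iter-multiple k m eq) ⟩
      iter φ m α                    ≈⟨ eq ⟩
      α                             ∎

    smallPeriod : ∀ {α} → IsPeriodic φ α →
                  ∃[ k ] iter φ (suc (toℕ {q} k)) α ≈ α
    smallPeriod {α} (m@(suc _) , _ , eq)
      with i , j , i<j , fi≡fj ←
             pigeonhole (ℕ.n<1+n q) (λ k → toFin (iter φ (toℕ k) α))
      with d , i+1+d≡j ← ℕ.m≤n⇒∃[o]m+o≡n i<j
      = fromℕ< d<q , trans (reflexive (≡.cong (λ e → iter φ (suc e) α)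
                                              (toℕ-fromℕ< d<q)))
                           period
      where
      a = toℕ i
      b = toℕ j

      d<q : d ℕ.< q
      d<q = ℕ.≤-trans
        (ℕ.≤-trans (s≤s (ℕ.m≤n+m d a)) (ℕ.≤-reflexive i+1+d≡j))
        (ℕ.≤-pred (toℕ<n j))

      M = a ℕ.* m
      r = M ℕ.∸ a

      r+a≡M : r ℕ.+ a ≡ M
      r+a≡M = ℕ.m∸n+n≡m (ℕ.m≤m*n a m)

      shift : suc d ℕ.+ M ≡ r ℕ.+ b
      shift = ≡.trans (≡.cong (suc d ℕ.+_) (≡.sym r+a≡M))
        (≡.trans (ℕ.+-comm (suc d) (r ℕ.+ a))
        (≡.trans (ℕ.+-assoc r a (suc d))
        (≡.cong (r ℕ.+_) (≡.trans (ℕ.+-suc a d) i+1+d≡j))))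

      M-period : iter φ M α ≈ α
      M-period = iter-multiple a m eq

      period : iter φ (suc d) α ≈ α
      period = begin
        iter φ (suc d) α              ≈⟨ iter-cong (suc d) M-period ⟨
        iter φ (suc d) (iter φ M α)   ≈⟨ iter-+ (suc d) M α ⟨
        iter φ (suc d ℕ.+ M) α        ≡⟨ ≡.cong (λ e → iter φ e α) shift ⟩
        iter φ (r ℕ.+ b) α            ≈⟨ iter-+ r b α ⟩
        iter φ r (iter φ b α)         ≈⟨ iter-cong r (toFin-injective fi≡fj) ⟨
        iter φ r (iter φ a α)         ≈⟨ iter-+ r a α ⟨
        iter φ (r ℕ.+ a) α            ≡⟨ ≡.cong (λ e → iter φ e α) r+a≡M ⟩
        iter φ M α                    ≈⟨ M-period ⟩
        α                             ∎

    isPeriodic? : ∀ α → Dec (IsPeriodic φ α)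
    isPeriodic? α = map′ (λ (k , eq) → suc (toℕ k) , ℕ.z<s , eq) smallPeriod
      (any? (λ k → iter φ (suc (toℕ k)) α ≟ α))

  #Per : ℤ[z] → ℕ
  #Per φ = length (filter (isPeriodic? φ) elements)

  -- #Per(φ, K) / q
  periodicProportion : ℤ[z] → ℚ
  periodicProportion φ = ((+ #Per φ) ℚ./ q) {{nonZeroIndex (toFin 0#)}}

{-# OPTIONS --safe #-}

-- Write q - 1 = 2^s t with t odd.  If S is a subgroup of the unit group that
-- contains every nonzero periodic point of squaring, then so does S², and
--   * if -1 ∈ S, squaring is two-to-one on S, so |S| = 2 |S²|;
--   * if -1 ∉ S, squaring is injective on S, so every point of S is periodic.
-- The second case occurs exactly when |S| is odd: negation is a fixed-point-free
-- involution of S when -1 ∈ S, while inversion fixes only 1 when -1 ∉ S.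
-- Descending from the unit group therefore ends after s steps, leaving t nonzero
-- periodic points, and (t + 1)/q differs from 1/2^s by less than 1/q.
-- For q = pⁿ, raising to an odd power does not change s, v₂(p² - 1) = μ + 1, and
-- every further squaring increases s by one.

module Submission where

open import Defs
import Algebra.Properties.Ring as RingProperties
open import Data.Fin.Base as Fin using (toℕ; zero; suc)
import Data.Fin.Properties as Fin
import Data.Integer.Properties as ℤ
open import Data.List.Base using (List; []; _∷_; allFin; filter; length; lookup)
open import Data.List.Properties using (filter-none; filter-all; length-map; length-tabulate)
import Data.List.Membership.Propositional.Properties as Membership
import Data.List.Membership.Setoid as MembershipOver
import Data.List.Membership.Setoid.Properties as SetoidMembership
open import Data.List.Relation.Unary.All as All using (All; []; _∷_)
open import Data.List.Relation.Unary.All.Properties using (all-filter)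
open import Data.List.Relation.Unary.AllPairs using ([]; _∷_)
import Data.List.Relation.Unary.Any as Any
import Data.List.Relation.Unary.Unique.Propositional.Properties as Unique
import Data.List.Relation.Unary.Unique.Setoid as UniqueOver
import Data.List.Relation.Unary.Unique.Setoid.Properties as SetoidUnique
open import Data.Nat using (ℕ; zero; suc; NonZero; >-nonZero; nonTrivial⇒n>1; _+_; _*_; _∸_; _^_;
  _≤_; _<_; _⊔_; z≤n; s≤s; z<s)
open import Data.Nat.Divisibility using (_∣_; divides; _∣?_; ∣-trans; ∣⇒≤; m∣m*n; 1∣_; *-cancelˡ-∣)
open import Data.Nat.Primality using (Prime; prime⇒nonTrivial)
import Data.Nat.Properties as ℕ
open import Data.Nat.Tactic.RingSolver using (solve-∀)
open import Data.Product using (_×_; _,_; ∃; ∃-syntax; proj₁; proj₂)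
open import Data.Rational.Base as ℚ using (ℚ; 0ℚ; ↧ₙ_; mkℚ)
import Data.Rational.Properties as ℚ
open import Data.Rational.Unnormalised.Base as ℚᵘ using (mkℚᵘ; _≃_; *<*)
import Data.Rational.Unnormalised.Properties as ℚᵘ
open import Data.Sum using (_⊎_; inj₁; inj₂; [_,_]′)
open import Function using (_∘_; id)
open import Function.Bundles using (Inverse)
open import Level using (Level) renaming (_⊔_ to _⊔ˡ_)
open import Relation.Binary.Bundles using (Setoid)
open import Relation.Binary.Definitions using (_Respects_; tri<; tri≈; tri>)
open import Relation.Binary.PropositionalEquality as ≡ using (_≡_)
import Relation.Binary.Reasoning.Setoid as SetoidReasoning
open import Relation.Nullary using (Dec; ¬_; yes; no; contradiction)
open import Relation.Nullary.Decidable using (map′; _×-dec_; ¬?)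
open import Relation.Unary using (Pred; Decidable)

private
  variable
    c ℓ a r r₁ r₂ r₃ : Level
    q : ℕ

-- Lengths of lists: disjoint unions and injections

module _ {A : Set a} {P : Pred A r₁} {Q : Pred A r₂} {R : Pred A r₃}
         (P? : Decidable P) (Q? : Decidable Q) (R? : Decidable R) where

  length-filter-⊎ : (∀ {x} → P x → Q x ⊎ R x) → (∀ {x} → Q x → P x) →
    (∀ {x} → R x → P x) → (∀ {x} → Q x → ¬ R x) → ∀ xs →
    length (filter P? xs) ≡ length (filter Q? xs) + length (filter R? xs)
  length-filter-⊎ split Q⇒P R⇒P disj = go
    where
    go : ∀ xs →
         length (filter P? xs) ≡ length (filter Q? xs) + length (filter R? xs)
    go [] = ≡.refl
    go (x ∷ xs) with P? x | Q? x | R? x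
    ... | yes _  | yes _  | no _   = ≡.cong suc (go xs)
    ... | yes _  | no _   | yes _  =
      ≡.trans (≡.cong suc (go xs)) (≡.sym (ℕ.+-suc _ _))
    ... | no _   | no _   | no _   = go xs
    ... | _      | yes qx | yes rx = contradiction rx (disj qx)
    ... | yes px | no ¬qx | no ¬rx = contradiction (split px) [ ¬qx , ¬rx ]′
    ... | no ¬px | yes qx | no _   = contradiction (Q⇒P qx) ¬px
    ... | no ¬px | no _   | yes rx = contradiction (R⇒P rx) ¬px

module _ (S : Setoid c ℓ) where
  open Setoid S
  open UniqueOver S using (Unique)
  open MembershipOver S using (_∈_)

  lookup-injective : ∀ {xs} → Unique xs →
                     ∀ i j → lookup xs i ≈ lookup xs j → i ≡ j
  lookup-injective (x∉ ∷ u) zero    zero    eq = ≡.refl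
  lookup-injective (x∉ ∷ u) zero    (suc j) eq =
    contradiction eq (All.lookup x∉ (Membership.∈-lookup j))
  lookup-injective (x∉ ∷ u) (suc i) zero    eq =
    contradiction (sym eq) (All.lookup x∉ (Membership.∈-lookup i))
  lookup-injective (x∉ ∷ u) (suc i) (suc j) eq =
    ≡.cong suc (lookup-injective u i j eq)

  module _ {P : Pred Carrier r₁} {xs ys : List Carrier} where

    -- Sending a position in `xs` to the position in `ys` of its image is an injection between
    -- finite index sets. The map takes the proof of `P x` as input, so the image may be built from
    -- a witness, such as a square root.
    injection⇒length≤ : Unique xs → All P xs →
      (f : ∀ {x} → P x → ∃ (_∈ ys)) →
      (∀ {x y} (px : P x) (py : P y) → proj₁ (f px) ≈ proj₁ (f py) → x ≈ y) →
      length xs ≤ length ys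
    injection⇒length≤ xs! pxs f f-inj = Fin.injective⇒≤ {f = Any.index ∘ proj₂ ∘ f ∘ p}
      (λ {i} {j} eq → lookup-injective xs! i j (f-inj (p i) (p j)
        (SetoidMembership.index-injective S (proj₂ (f (p i))) (proj₂ (f (p j))) eq)))
      where
      p : ∀ i → P (lookup xs i)
      p i = All.lookup pxs (Membership.∈-lookup i)

-- Counting in a finite field

module _ (K : FiniteField c ℓ q) where
  open FiniteField K hiding (zero) renaming (_+_ to _⊕_; _*_ to _⊗_)
  open UniqueOver setoid using (Unique)
  open MembershipOver setoid using (_∈_)

  fromFin-injective : ∀ {i j} → fromFin i ≈ fromFin j → i ≡ j
  fromFin-injective eq =
    ≡.trans (≡.sym (Inverse.strictlyInverseˡ index _)) (Inverse.inverseˡ index eq)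

  elements-unique : Unique elements
  elements-unique =
    SetoidUnique.map⁺ (≡.setoid _) setoid fromFin-injective (Unique.allFin⁺ q)

  elements-complete : ∀ x → x ∈ elements
  elements-complete x = SetoidMembership.∈-resp-≈ setoid
    (Inverse.strictlyInverseʳ index x)
    (SetoidMembership.∈-map⁺ (≡.setoid _) setoid (reflexive ∘ ≡.cong fromFin)
      (Membership.∈-allFin (toFin x)))

  count : {P : Pred Carrier r₁} → Decidable P → ℕ
  count P? = length (filter P? elements)

  any? : {P : Pred Carrier r₁} → Decidable P → P Respects _≈_ → Dec (∃ P)
  any? P? resp = map′ (λ (i , p) → fromFin i , p)
    (λ (x , p) → toFin x , resp (sym (Inverse.strictlyInverseʳ index x)) p)
    (Fin.any? (P? ∘ fromFin))

  module _ {P : Pred Carrier r₁} {Q : Pred Carrier r₂}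
           (P? : Decidable P) (Q? : Decidable Q) (Q-resp : Q Respects _≈_) where

    injection⇒count≤ : (f : ∀ {x} → P x → ∃ Q) →
      (∀ {x y} (px : P x) (py : P y) → proj₁ (f px) ≈ proj₁ (f py) → x ≈ y) →
      count P? ≤ count Q?
    injection⇒count≤ f = injection⇒length≤ setoid
      (SetoidUnique.filter⁺ setoid P? elements-unique) (all-filter P? elements)
      (λ px → let y , qy = f px in
        y , SetoidMembership.∈-filter⁺ setoid Q? Q-resp (elements-complete y) qy)

  count-cong : {P : Pred Carrier r₁} {Q : Pred Carrier r₂}
    (P? : Decidable P) (Q? : Decidable Q) → P Respects _≈_ → Q Respects _≈_ →
    (∀ {x} → P x → Q x) → (∀ {x} → Q x → P x) → count P? ≡ count Q?
  count-cong P? Q? P-resp Q-resp P⇒Q Q⇒P = ℕ.≤-antisym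
    (injection⇒count≤ P? Q? Q-resp (λ px → _ , P⇒Q px) (λ _ _ eq → eq))
    (injection⇒count≤ Q? P? P-resp (λ qx → _ , Q⇒P qx) (λ _ _ eq → eq))

  count-∅ : {P : Pred Carrier r₁} (P? : Decidable P) → (∀ {x} → ¬ P x) → count P? ≡ 0
  count-∅ P? ¬p = ≡.cong length (filter-none P? {elements} (All.universal (λ _ → ¬p) _))

  count-singleton : {P : Pred Carrier r₁} (P? : Decidable P) → P Respects _≈_ →
    ∀ {a} → P a → (∀ {x} → P x → x ≈ a) → count P? ≡ 1
  count-singleton P? P-resp {a} pa only =
    go (SetoidUnique.filter⁺ setoid P? elements-unique) (all-filter P? elements)
       (SetoidMembership.∈-filter⁺ setoid P? P-resp (elements-complete a) pa)
    where
    go : ∀ {xs} → Unique xs → All _ xs → a ∈ xs → length xs ≡ 1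
    go {x ∷ []}    _                 _             _ = ≡.refl
    go {x ∷ y ∷ _} ((x≉y ∷ _) ∷ _) (px ∷ py ∷ _) _ =
      contradiction (trans (only px) (sym (only py))) x≉y

  count-universal : {P : Pred Carrier r₁} (P? : Decidable P) → (∀ x → P x) → count P? ≡ q
  count-universal P? p = ≡.trans (≡.cong length (filter-all P? (All.universal p elements)))
    (≡.trans (length-map fromFin (allFin q)) (length-tabulate {n = q} _))

  infix 4 _≺_
  -- An auxiliary order pulled back from `Fin q`, unrelated to the field operations. It serves to
  -- pick one element from each two-element orbit of an involution.
  _≺_ : Carrier → Carrier → Set
  x ≺ y = toFin x Fin.< toFin y

  _≺?_ : ∀ x y → Dec (x ≺ y)
  x ≺? y = toFin x Fin.<? toFin y

  ≺-resp : ∀ {x x′ y y′} → x ≈ x′ → y ≈ y′ → x ≺ y → x′ ≺ y′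
  ≺-resp x≈ y≈ = ≡.subst₂ Fin._<_ (toFin-cong x≈) (toFin-cong y≈)

  module Involution {P : Pred Carrier r₁} (P? : Decidable P) (P-resp : P Respects _≈_)
    (f : Carrier → Carrier) (f-cong : ∀ {x y} → x ≈ y → f x ≈ f y)
    (f-closed : ∀ {x} → P x → P (f x)) (f-invol : ∀ {x} → P x → f (f x) ≈ x) where

    fixed? : Decidable (λ x → P x × f x ≈ x)
    fixed? x = P? x ×-dec f x ≟ x

    ascends? : Decidable (λ x → P x × x ≺ f x)
    ascends? x = P? x ×-dec x ≺? f x

    descends? : Decidable (λ x → P x × f x ≺ x)
    descends? x = P? x ×-dec f x ≺? x

    moved? : Decidable (λ x → P x × ¬ f x ≈ x)
    moved? x = P? x ×-dec ¬? (f x ≟ x)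

    ascends-resp : (λ x → P x × x ≺ f x) Respects _≈_
    ascends-resp x≈y (p , lt) = P-resp x≈y p , ≺-resp x≈y (f-cong x≈y) lt

    descends-resp : (λ x → P x × f x ≺ x) Respects _≈_
    descends-resp x≈y (p , lt) = P-resp x≈y p , ≺-resp (f-cong x≈y) x≈y lt

    f-injective : ∀ {x y} → P x → P y → f x ≈ f y → x ≈ y
    f-injective px py eq = trans (sym (f-invol px)) (trans (f-cong eq) (f-invol py))

    count-ascends≡descends : count ascends? ≡ count descends?
    count-ascends≡descends = ℕ.≤-antisym
      (injection⇒count≤ ascends? descends? descends-resp
        (λ (p , lt) → _ , f-closed p , ≺-resp (sym (f-invol p)) refl lt)
        (λ (px , _) (py , _) → f-injective px py))
      (injection⇒count≤ descends? ascends? ascends-resp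
        (λ (p , lt) → _ , f-closed p , ≺-resp refl (sym (f-invol p)) lt)
        (λ (px , _) (py , _) → f-injective px py))

    -- A moved point and its image are in opposite order, and `f` exchanges ascending and descending
    -- points. Each moved pair thus contains exactly one ascending point, and the parity of the
    -- count is that of the number of fixed points.
    count-involution : count P? ≡ 2 * count ascends? + count fixed?
    count-involution = begin
      count P?
        ≡⟨ length-filter-⊎ P? moved? fixed? moved⊎fixed proj₁ proj₁
             (λ (_ , ¬fix) (_ , fix) → ¬fix fix) elements ⟩
      count moved? + count fixed?
        ≡⟨ ≡.cong (_+ count fixed?) (length-filter-⊎ moved? ascends? descends?
             ascends⊎descends
             (λ (p , lt) → p , λ eq → Fin.<⇒≢ lt (toFin-cong (sym eq)))
             (λ (p , lt) → p , λ eq → Fin.<⇒≢ lt (toFin-cong eq))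
             (λ (_ , lt) (_ , gt) → Fin.<-asym lt gt) elements) ⟩
      (count ascends? + count descends?) + count fixed?
        ≡⟨ ≡.cong (λ k → (count ascends? + k) + count fixed?)
             (≡.trans (≡.sym count-ascends≡descends) (≡.sym (ℕ.+-identityʳ _))) ⟩
      2 * count ascends? + count fixed? ∎
      where
      open ≡.≡-Reasoning
      moved⊎fixed : ∀ {x} → P x → (P x × ¬ f x ≈ x) ⊎ (P x × f x ≈ x)
      moved⊎fixed {x} p with f x ≟ x
      ... | yes eq = inj₂ (p , eq)
      ... | no ¬eq = inj₁ (p , ¬eq)
      ascends⊎descends : ∀ {x} → P x × ¬ f x ≈ x → (P x × x ≺ f x) ⊎ (P x × f x ≺ x)
      ascends⊎descends {x} (p , ¬fix) with Fin.<-cmp (toFin x) (toFin (f x))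
      ... | tri< lt _ _ = inj₁ (p , lt)
      ... | tri≈ _ eq _ = contradiction (toFin-injective (≡.sym eq)) ¬fix
      ... | tri> _ _ gt = inj₂ (p , gt)

-- Periodic points of squaring in a field of odd order

module OddField (K : FiniteField c ℓ q) {h : ℕ} (q-odd : q ≡ suc (2 * h)) where
  open FiniteField K hiding (zero) renaming (_+_ to _⊕_; _*_ to _⊗_)
  open RingProperties ring
  open SetoidReasoning setoid

  -- Otherwise x ↦ x + 1 would be an involution without fixed points.
  1+1≉0 : ¬ 1# ⊕ 1# ≈ 0#
  1+1≉0 1+1≈0 = ℕ.even≢odd (count K ascends?) h (≡.trans (≡.sym eq) q-odd)
    where
    shift-invol : ∀ x → (x ⊕ 1#) ⊕ 1# ≈ x
    shift-invol x = begin
      (x ⊕ 1#) ⊕ 1# ≈⟨ +-assoc x 1# 1# ⟩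
      x ⊕ (1# ⊕ 1#) ≈⟨ +-congˡ 1+1≈0 ⟩
      x ⊕ 0#        ≈⟨ +-identityʳ x ⟩
      x             ∎
    open Involution K {P = λ x → x ≈ x} (λ _ → yes refl) (λ _ _ → refl)
      (_⊕ 1#) +-congʳ (λ _ → refl) (λ {x} _ → shift-invol x)
    shift≉ : ∀ {x} → ¬ x ⊕ 1# ≈ x
    shift≉ {x} x+1≈x = 0≉1 (+-cancelˡ x 0# 1# (trans (+-identityʳ x) (sym x+1≈x)))
    eq : q ≡ 2 * count K ascends?
    eq = ≡.trans (≡.sym (count-universal K {P = λ x → x ≈ x} (λ _ → yes refl) (λ _ → refl)))
      (≡.trans count-involution
      (≡.trans (≡.cong (2 * count K ascends? +_) (count-∅ K fixed? (shift≉ ∘ proj₂)))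
               (ℕ.+-identityʳ _)))

  -- Zero divisors, inverses and square roots

  x*y≈0⇒x≈0⊎y≈0 : ∀ {x y} → x ⊗ y ≈ 0# → x ≈ 0# ⊎ y ≈ 0#
  x*y≈0⇒x≈0⊎y≈0 {x} {y} xy≈0 with x ≟ 0#
  ... | yes x≈0 = inj₁ x≈0
  ... | no x≉0 = let z , xz≈1 = inverse x x≉0 in inj₂ (begin
    y           ≈⟨ *-identityˡ y ⟨
    1# ⊗ y      ≈⟨ *-congʳ xz≈1 ⟨
    (x ⊗ z) ⊗ y ≈⟨ *-congʳ (*-comm x z) ⟩
    (z ⊗ x) ⊗ y ≈⟨ *-assoc z x y ⟩
    z ⊗ (x ⊗ y) ≈⟨ *-congˡ xy≈0 ⟩
    z ⊗ 0#      ≈⟨ zeroʳ z ⟩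
    0#          ∎)

  infix 9 _⁻¹
  -- Made total by the default value 0 at 0, so that it can be the map of an `Involution`.
  _⁻¹ : Carrier → Carrier
  x ⁻¹ with x ≟ 0#
  ... | yes _  = 0#
  ... | no x≉0 = proj₁ (inverse x x≉0)

  *-inverseʳ : ∀ {x} → ¬ x ≈ 0# → x ⊗ x ⁻¹ ≈ 1#
  *-inverseʳ {x} x≉0 with x ≟ 0#
  ... | yes x≈0 = contradiction x≈0 x≉0
  ... | no x≉0′ = proj₂ (inverse x x≉0′)

  *≈1⇒≉0 : ∀ {x y} → x ⊗ y ≈ 1# → ¬ x ≈ 0#
  *≈1⇒≉0 {x} {y} xy≈1 x≈0 = 0≉1 (trans (sym (zeroˡ y)) (trans (*-congʳ (sym x≈0)) xy≈1))

  ⁻¹-unique : ∀ {x y} → x ⊗ y ≈ 1# → x ⁻¹ ≈ y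
  ⁻¹-unique {x} {y} xy≈1 = begin
    x ⁻¹             ≈⟨ *-identityʳ (x ⁻¹) ⟨
    x ⁻¹ ⊗ 1#        ≈⟨ *-congˡ xy≈1 ⟨
    x ⁻¹ ⊗ (x ⊗ y)   ≈⟨ *-assoc (x ⁻¹) x y ⟨
    (x ⁻¹ ⊗ x) ⊗ y   ≈⟨ *-congʳ (trans (*-comm (x ⁻¹) x) (*-inverseʳ (*≈1⇒≉0 xy≈1))) ⟩
    1# ⊗ y           ≈⟨ *-identityˡ y ⟩
    y                ∎

  -- The choice made by `inverse` is not assumed to respect `_≈_`; uniqueness of inverses supplies
  -- this.
  ⁻¹-cong : ∀ {x y} → x ≈ y → x ⁻¹ ≈ y ⁻¹
  ⁻¹-cong {x} {y} x≈y with x ≟ 0# | y ≟ 0#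
  ... | yes _  | yes _   = refl
  ... | yes x≈0 | no y≉0 = contradiction (trans (sym x≈y) x≈0) y≉0
  ... | no x≉0 | yes y≈0 = contradiction (trans x≈y y≈0) x≉0
  ... | no x≉0 | no y≉0  = trans (sym (⁻¹-unique (proj₂ (inverse x x≉0))))
                                 (⁻¹-unique (trans (*-congʳ x≈y) (proj₂ (inverse y y≉0))))

  -x*-x≈x*x : ∀ x → - x ⊗ - x ≈ x ⊗ x
  -x*-x≈x*x x = begin
    - x ⊗ - x      ≈⟨ -‿distribˡ-* x (- x) ⟨
    - (x ⊗ - x)    ≈⟨ -‿cong (-‿distribʳ-* x x) ⟨
    - (- (x ⊗ x))  ≈⟨ -‿involutive (x ⊗ x) ⟩
    x ⊗ x          ∎

  x*x≈y*y⇒x≈y⊎x≈-y : ∀ {x y} → x ⊗ x ≈ y ⊗ y → x ≈ y ⊎ x ≈ - y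
  x*x≈y*y⇒x≈y⊎x≈-y {x} {y} x²≈y² with x*y≈0⇒x≈0⊎y≈0 product≈0
    where
    product≈0 : (x ⊕ y) ⊗ (x ⊕ - y) ≈ 0#
    product≈0 = begin
      (x ⊕ y) ⊗ (x ⊕ - y)                     ≈⟨ x[y-z]≈xy-xz (x ⊕ y) x y ⟩
      (x ⊕ y) ⊗ x ⊕ - ((x ⊕ y) ⊗ y)           ≈⟨ +-congˡ (-‿cong expand) ⟩
      (x ⊕ y) ⊗ x ⊕ - ((x ⊕ y) ⊗ x)           ≈⟨ -‿inverseʳ _ ⟩
      0#                                      ∎
      where
      expand : (x ⊕ y) ⊗ y ≈ (x ⊕ y) ⊗ x
      expand = begin
        (x ⊕ y) ⊗ y     ≈⟨ distribʳ y x y ⟩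
        x ⊗ y ⊕ y ⊗ y   ≈⟨ +-cong (*-comm x y) (sym x²≈y²) ⟩
        y ⊗ x ⊕ x ⊗ x   ≈⟨ +-comm (y ⊗ x) (x ⊗ x) ⟩
        x ⊗ x ⊕ y ⊗ x   ≈⟨ distribʳ x x y ⟨
        (x ⊕ y) ⊗ x     ∎
  ... | inj₁ x+y≈0 = inj₂ (+-inverseˡ-unique x y x+y≈0)
  ... | inj₂ x-y≈0 = inj₁ (x∙y⁻¹≈ε⇒x≈y x y x-y≈0)

  -- The hypothesis gives x(1 + 1) = x + x = 0. The odd order of the field enters here, through
  -- `1+1≉0`.
  -x≈x⇒x≈0 : ∀ {x} → - x ≈ x → x ≈ 0#
  -x≈x⇒x≈0 {x} -x≈x = [ id , (λ 2≈0 → contradiction 2≈0 1+1≉0) ]′ (x*y≈0⇒x≈0⊎y≈0 (begin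
    x ⊗ (1# ⊕ 1#)    ≈⟨ distribˡ x 1# 1# ⟩
    x ⊗ 1# ⊕ x ⊗ 1#  ≈⟨ +-cong (*-identityʳ x) (*-identityʳ x) ⟩
    x ⊕ x            ≈⟨ +-congʳ -x≈x ⟨
    - x ⊕ x          ≈⟨ -‿inverseˡ x ⟩
    0#               ∎))

  x*x≈0⇒x≈0 : ∀ {x} → x ⊗ x ≈ 0# → x ≈ 0#
  x*x≈0⇒x≈0 = [ id , id ]′ ∘ x*y≈0⇒x≈0⊎y≈0

  -- Subgroups of the unit group and their squares

  record IsSubgroup (S : Pred Carrier r) : Set (c ⊔ˡ ℓ ⊔ˡ r) where
    field
      resp      : S Respects _≈_
      ≉0        : ∀ {x} → S x → ¬ x ≈ 0#
      1∈        : S 1#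
      *-closed  : ∀ {x y} → S x → S y → S (x ⊗ y)
      ⁻¹-closed : ∀ {x} → S x → S (x ⁻¹)

  units : IsSubgroup (λ x → ¬ x ≈ 0#)
  units = record
    { resp      = λ x≈y x≉0 y≈0 → x≉0 (trans x≈y y≈0)
    ; ≉0        = id
    ; 1∈        = 0≉1 ∘ sym
    ; *-closed  = λ x≉0 y≉0 → [ x≉0 , y≉0 ]′ ∘ x*y≈0⇒x≈0⊎y≈0
    ; ⁻¹-closed = λ {x} x≉0 → *≈1⇒≉0 (trans (*-comm (x ⁻¹) x) (*-inverseʳ x≉0))
    }

  Squares : Pred Carrier r → Pred Carrier (c ⊔ˡ ℓ ⊔ˡ r)
  Squares S x = ∃[ y ] (S y × y ⊗ y ≈ x)

  module Subgroup {S : Pred Carrier r} (S? : Decidable S) (S-sub : IsSubgroup S) where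
    open IsSubgroup S-sub

    squares? : Decidable (Squares S)
    squares? x = any? K (λ y → S? y ×-dec y ⊗ y ≟ x)
      (λ y≈z (s , eq) → resp y≈z s , trans (sym (*-cong y≈z y≈z)) eq)

    squares-subgroup : IsSubgroup (Squares S)
    squares-subgroup = record
      { resp      = λ x≈z (y , s , eq) → y , s , trans eq x≈z
      ; ≉0        = λ (y , s , eq) x≈0 → ≉0 s (x*x≈0⇒x≈0 (trans eq x≈0))
      ; 1∈        = 1# , 1∈ , *-identityˡ 1#
      ; *-closed  = λ {x} {x′} (y , s , eq) (z , s′ , eq′) → y ⊗ z , *-closed s s′ ,
                      trans (interchange y z) (*-cong eq eq′)
      ; ⁻¹-closed = λ {x} (y , s , eq) → y ⁻¹ , ⁻¹-closed s , sym (⁻¹-unique (begin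
          x ⊗ (y ⁻¹ ⊗ y ⁻¹)         ≈⟨ *-congʳ eq ⟨
          (y ⊗ y) ⊗ (y ⁻¹ ⊗ y ⁻¹)   ≈⟨ interchange y (y ⁻¹) ⟨
          (y ⊗ y ⁻¹) ⊗ (y ⊗ y ⁻¹)   ≈⟨ *-cong (*-inverseʳ (≉0 s)) (*-inverseʳ (≉0 s)) ⟩
          1# ⊗ 1#                   ≈⟨ *-identityˡ 1# ⟩
          1#                        ∎))
      }
      where
      interchange : ∀ y z → (y ⊗ z) ⊗ (y ⊗ z) ≈ (y ⊗ y) ⊗ (z ⊗ z)
      interchange y z = begin
        (y ⊗ z) ⊗ (y ⊗ z)   ≈⟨ *-assoc y z (y ⊗ z) ⟩
        y ⊗ (z ⊗ (y ⊗ z))   ≈⟨ *-congˡ (*-assoc z y z) ⟨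
        y ⊗ ((z ⊗ y) ⊗ z)   ≈⟨ *-congˡ (*-congʳ (*-comm z y)) ⟩
        y ⊗ ((y ⊗ z) ⊗ z)   ≈⟨ *-congˡ (*-assoc y z z) ⟩
        y ⊗ (y ⊗ (z ⊗ z))   ≈⟨ *-assoc y y (z ⊗ z) ⟨
        (y ⊗ y) ⊗ (z ⊗ z)   ∎

    module _ (-1∈ : S (- 1#)) where

      neg-closed : ∀ {x} → S x → S (- x)
      neg-closed {x} s = resp (-1*x≈-x x) (*-closed -1∈ s)

      open Involution K S? resp -_ -‿cong neg-closed (λ {x} _ → -‿involutive x)

      -- The roots y and -y differ because y is nonzero, so exactly one of them precedes its
      -- negative. This singles out one root of each square.
      ascending-root : ∀ {x} → Squares S x → ∃[ y ] ((S y × _≺_ K y (- y)) × y ⊗ y ≈ x)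
      ascending-root (y , s , eq) with Fin.<-cmp (toFin y) (toFin (- y))
      ... | tri< lt _ _ = y , (s , lt) , eq
      ... | tri≈ _ y≡-y _ = contradiction (-x≈x⇒x≈0 (toFin-injective (≡.sym y≡-y))) (≉0 s)
      ... | tri> _ _ gt = - y ,
        (neg-closed s , ≺-resp K refl (sym (-‿involutive y)) gt) ,
        trans (-x*-x≈x*x y) eq

      -- Negation has no fixed point in S, so half of S is ascending. Squaring maps that half
      -- injectively into the squares, and `ascending-root` gives an injection back.
      count-squares : count K S? ≡ 2 * count K squares?
      count-squares = ≡.trans count-involution
        (≡.trans (≡.cong₂ (λ m n → 2 * m + n) ascends≡squares
                   (count-∅ K fixed? (λ (s , eq) → ≉0 s (-x≈x⇒x≈0 eq))))
                 (ℕ.+-identityʳ _))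
        where
        ascends≡squares : count K ascends? ≡ count K squares?
        ascends≡squares = ℕ.≤-antisym
          (injection⇒count≤ K ascends? squares? (IsSubgroup.resp squares-subgroup)
            (λ {x} (s , _) → x ⊗ x , x , s , refl)
            -- If x were -y, then x ≺ -x would read -y ≺ y, against y ≺ -y.
            (λ {x} {y} (_ , x≺-x) (_ , y≺-y) eq → [ id , (λ x≈-y → contradiction
              (≺-resp K x≈-y (trans (-‿cong x≈-y) (-‿involutive y)) x≺-x)
              (Fin.<-asym y≺-y)) ]′
              (x*x≈y*y⇒x≈y⊎x≈-y eq)))
          (injection⇒count≤ K squares? ascends? ascends-resp
            (λ sq → let y , asc , _ = ascending-root sq in y , asc)
            (λ sq sq′ eq → let _ , _ , y²≈x = ascending-root sq
                               _ , _ , z²≈w = ascending-root sq′ in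
              trans (sym y²≈x) (trans (*-cong eq eq) z²≈w)))

    module _ (-1∉ : ¬ S (- 1#)) where

      -- A fixed point of inversion satisfies x² = 1, so it is 1 or -1, and -1 is excluded.
      count-odd : ∃[ k ] count K S? ≡ suc (2 * k)
      count-odd = count K ascends? , ≡.trans count-involution
        (≡.trans (≡.cong (2 * count K ascends? +_)
                   (count-singleton K fixed? fixed-resp
                     (1∈ , ⁻¹-unique (*-identityˡ 1#)) only-1))
                 (ℕ.+-comm _ 1))
        where
        ⁻¹-involutive : ∀ {x} → S x → (x ⁻¹) ⁻¹ ≈ x
        ⁻¹-involutive {x} s = ⁻¹-unique (trans (*-comm (x ⁻¹) x) (*-inverseʳ (≉0 s)))
        open Involution K S? resp _⁻¹ ⁻¹-cong ⁻¹-closed ⁻¹-involutive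
        fixed-resp : (λ x → S x × x ⁻¹ ≈ x) Respects _≈_
        fixed-resp x≈y (s , eq) = resp x≈y s , trans (⁻¹-cong (sym x≈y)) (trans eq x≈y)
        only-1 : ∀ {x} → S x × x ⁻¹ ≈ x → x ≈ 1#
        only-1 {x} (s , eq) = [ id , (λ x≈-1 → contradiction (resp x≈-1 s) -1∉) ]′
          (x*x≈y*y⇒x≈y⊎x≈-y (begin
            x ⊗ x    ≈⟨ *-congˡ eq ⟨
            x ⊗ x ⁻¹ ≈⟨ *-inverseʳ (≉0 s) ⟩
            1#       ≈⟨ *-identityˡ 1# ⟨
            1# ⊗ 1#  ∎))

      -- Equal squares leave x = y or x = -y, and the latter would put the quotient of x by y, which
      -- is -1, into S.
      squaring-injective : ∀ {x y} → S x → S y → x ⊗ x ≈ y ⊗ y → x ≈ y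
      squaring-injective {x} {y} sx sy eq = [ id , (λ x≈-y → contradiction
        (resp (begin
          x ⊗ y ⁻¹       ≈⟨ *-congʳ x≈-y ⟩
          - y ⊗ y ⁻¹     ≈⟨ -‿distribˡ-* y (y ⁻¹) ⟨
          - (y ⊗ y ⁻¹)   ≈⟨ -‿cong (*-inverseʳ (≉0 sy)) ⟩
          - 1#           ∎) (*-closed sx (⁻¹-closed sy))) -1∉) ]′
        (x*x≈y*y⇒x≈y⊎x≈-y eq)

  -- Iterated squaring and the descent through subgroups

  eval-z² : ∀ x → eval K z² x ≈ x ⊗ x
  eval-z² x = begin
    -- The Horner form of `z²` unfolded: `1# ⊕ 0#` is `fromℤ (+ 1)`, and the last `0#` is the value
    -- of the empty tail.
    0# ⊕ x ⊗ (0# ⊕ x ⊗ ((1# ⊕ 0#) ⊕ x ⊗ 0#)) ≈⟨ +-identityˡ _ ⟩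
    x ⊗ (0# ⊕ x ⊗ ((1# ⊕ 0#) ⊕ x ⊗ 0#))      ≈⟨ *-congˡ (+-identityˡ _) ⟩
    x ⊗ (x ⊗ ((1# ⊕ 0#) ⊕ x ⊗ 0#))
      ≈⟨ *-congˡ (*-congˡ (+-cong (+-identityʳ 1#) (zeroʳ x))) ⟩
    x ⊗ (x ⊗ (1# ⊕ 0#))   ≈⟨ *-congˡ (*-congˡ (+-identityʳ 1#)) ⟩
    x ⊗ (x ⊗ 1#)          ≈⟨ *-congˡ (*-identityʳ x) ⟩
    x ⊗ x                 ∎

  sq^ : ℕ → Carrier → Carrier
  sq^ = iter K z²

  Periodic : Pred Carrier ℓ
  Periodic = IsPeriodic K z²

  Periodic* : Pred Carrier ℓ
  Periodic* x = Periodic x × ¬ x ≈ 0#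

  periodic-resp : Periodic Respects _≈_
  periodic-resp x≈y (m , 0<m , eq) =
    m , 0<m , trans (iter-cong K z² m (sym x≈y)) (trans eq x≈y)

  periodic*-resp : Periodic* Respects _≈_
  periodic*-resp x≈y (p , x≉0) = periodic-resp x≈y p , λ y≈0 → x≉0 (trans x≈y y≈0)

  periodic? : Decidable Periodic
  periodic? = isPeriodic? K z²

  periodic*? : Decidable Periodic*
  periodic*? x = periodic? x ×-dec ¬? (x ≟ 0#)

  periodic-0 : Periodic 0#
  periodic-0 = 1 , z<s , trans (eval-z² 0#) (zeroˡ 0#)

  -- The predecessor of x on its cycle is a square root of x on the same cycle. Hence a subgroup
  -- containing all nonzero periodic points keeps them when replaced by its squares.
  periodic*-root : ∀ {x} → Periodic* x → Squares Periodic* x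
  periodic*-root {x} ((suc m , _ , eq) , x≉0) = y , ((suc m , z<s , y-period) , y≉0) , y²≈x
    where
    y = sq^ m x
    y²≈x : y ⊗ y ≈ x
    y²≈x = trans (sym (eval-z² y)) eq
    y≉0 : ¬ y ≈ 0#
    y≉0 y≈0 = x≉0 (trans (sym y²≈x) (trans (*-congʳ y≈0) (zeroˡ y)))
    y-period : sq^ (suc m) y ≈ y
    y-period = begin
      sq^ (suc m) (sq^ m x)   ≈⟨ iter-+ K z² (suc m) m x ⟨
      sq^ (suc m + m) x       ≡⟨ ≡.cong (λ e → sq^ e x) (ℕ.+-comm (suc m) m) ⟩
      sq^ (m + suc m) x       ≈⟨ iter-+ K z² m (suc m) x ⟩
      sq^ m (sq^ (suc m) x)   ≈⟨ iter-cong K z² m eq ⟩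
      sq^ m x                 ∎

  module _ {S : Pred Carrier r} (S? : Decidable S) (S-sub : IsSubgroup S)
           (-1∉ : ¬ S (- 1#)) where
    open IsSubgroup S-sub

    iter-closed : ∀ m {x} → S x → S (sq^ m x)
    iter-closed zero    s = s
    iter-closed (suc m) s = resp (sym (eval-z² _)) (*-closed (iter-closed m s) (iter-closed m s))

    iter-cancel : ∀ {x} → S x → ∀ i d → sq^ i x ≈ sq^ (i + d) x → x ≈ sq^ d x
    iter-cancel s zero    d eq = eq
    iter-cancel s (suc i) d eq = iter-cancel s i d
      (Subgroup.squaring-injective S? S-sub -1∉ (iter-closed i s) (iter-closed (i + d) s)
        (trans (sym (eval-z² _)) (trans eq (eval-z² _))))

    -- By the pigeonhole principle two iterates of x agree. Squaring is injective on S, so the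
    -- common initial squarings cancel and x itself recurs.
    all-periodic : ∀ {x} → S x → Periodic x
    all-periodic {x} s
      with i , j , i<j , fi≡fj ← Fin.pigeonhole (ℕ.n<1+n q) (λ k → toFin (sq^ (toℕ k) x))
      with d , i+1+d≡j ← ℕ.m≤n⇒∃[o]m+o≡n i<j
      = suc d , z<s , sym (iter-cancel s (toℕ i) (suc d) (trans (toFin-injective fi≡fj)
          (reflexive (≡.cong (λ e → sq^ e x) (≡.sym (≡.trans (ℕ.+-suc (toℕ i) d) i+1+d≡j))))))

  -- Induction on s, with the parity of the order of S deciding whether -1 lies in S. S is
  -- generalised over its level because `Squares` may raise it at each step.
  count-periodic* : ∀ s k {S : Pred Carrier r} (S? : Decidable S) → IsSubgroup S →
    (∀ {x} → Periodic* x → S x) → count K S? ≡ 2 ^ s * suc (2 * k) →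
    count K periodic*? ≡ suc (2 * k)
  count-periodic* zero k S? S-sub Per⊆S eq = ≡.trans
    (count-cong K periodic*? S? periodic*-resp resp Per⊆S
      (λ s → all-periodic S? S-sub -1∉ s , ≉0 s))
    (≡.trans eq (ℕ.*-identityˡ _))
    where
    open IsSubgroup S-sub
    open Subgroup S? S-sub
    -- The order of S is odd here, while -1 in S would make it twice the number of squares.
    -1∉ = λ -1∈ → ℕ.even≢odd (count K squares?) k
      (≡.trans (≡.sym (count-squares -1∈)) (≡.trans eq (ℕ.*-identityˡ _)))
  count-periodic* (suc s) k S? S-sub Per⊆S eq with S? (- 1#)
  -- Without -1 the order would be odd, against the factor `2 ^ suc s`.
  ... | no -1∉ = let l , odd = Subgroup.count-odd S? S-sub -1∉ in
    contradiction (≡.trans (≡.sym (ℕ.*-assoc 2 (2 ^ s) (suc (2 * k)))) (≡.trans (≡.sym eq) odd))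
                  (ℕ.even≢odd (2 ^ s * suc (2 * k)) l)
  ... | yes -1∈ = count-periodic* s k squares? squares-subgroup
    (λ p → let y , py , eq = periodic*-root p in y , Per⊆S py , eq)
    (ℕ.*-cancelˡ-≡ _ _ 2 (≡.trans (≡.sym (count-squares -1∈))
      (≡.trans eq (ℕ.*-assoc 2 (2 ^ s) (suc (2 * k))))))
    where open Subgroup S? S-sub

  zero? : Decidable (_≈ 0#)
  zero? = _≟ 0#

  count-zero : count K zero? ≡ 1
  count-zero = count-singleton K zero? (λ x≈y x≈0 → trans (sym x≈y) x≈0) refl id

  ≈0⊎≉0 : ∀ x → x ≈ 0# ⊎ ¬ x ≈ 0#
  ≈0⊎≉0 x with x ≟ 0#
  ... | yes x≈0 = inj₁ x≈0
  ... | no  x≉0 = inj₂ x≉0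

  -- The descent starts from the q - 1 units and leaves 2k + 1 nonzero periodic points; the point 0
  -- is fixed and adds one more.
  #Per-z² : ∀ s k → q ≡ suc (2 ^ s * suc (2 * k)) → #Per K z² ≡ suc (suc (2 * k))
  #Per-z² s k q≡ = ≡.trans
    (length-filter-⊎ periodic? zero? periodic*?
      (λ {x} p → [ inj₁ , (λ x≉0 → inj₂ (p , x≉0)) ]′ (≈0⊎≉0 x))
      (λ x≈0 → periodic-resp (sym x≈0) periodic-0) proj₁ (λ x≈0 (_ , x≉0) → x≉0 x≈0) elements)
    (≡.cong₂ _+_ count-zero
      (count-periodic* s k nonzero? units proj₂ count-nonzero))
    where
    nonzero? : Decidable (λ x → ¬ x ≈ 0#)
    nonzero? x = ¬? (x ≟ 0#)
    count-nonzero : count K nonzero? ≡ 2 ^ s * suc (2 * k)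
    count-nonzero = ℕ.suc-injective (≡.trans (≡.sym (≡.trans
      (≡.sym (count-universal K {P = λ x → x ≈ x} (λ _ → yes refl) (λ _ → refl)))
      (≡.trans (length-filter-⊎ {P = λ x → x ≈ x} (λ _ → yes refl) zero? nonzero?
          (λ {x} _ → ≈0⊎≉0 x) (λ _ → refl) (λ _ → refl) (λ x≈0 x≉0 → x≉0 x≈0) elements)
        (≡.cong (_+ count K nonzero?) count-zero)))) q≡)

-- The 2-adic valuation of pⁿ - 1

n<m^n : ∀ {m} → 1 < m → ∀ n → n < m ^ n
n<m^n 1<m zero    = z<s
n<m^n {m@(suc _)} 1<m (suc n) = ℕ.≤-<-trans (n<m^n 1<m n)
  (ℕ.<-≤-trans (ℕ.m<m*n (m ^ n) m {{ℕ.m^n≢0 m n}} 1<m) (ℕ.≤-reflexive (ℕ.*-comm (m ^ n) m)))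

maxPow2-∣ : ∀ n k → 2 ^ maxPow2 n k ∣ n
maxPow2-∣ n zero    = 1∣ n
maxPow2-∣ n (suc k) with 2 ^ suc k ∣? n
... | yes 2^∣n = 2^∣n
... | no  _    = maxPow2-∣ n k

maxPow2-maximal : ∀ n {j} k → j ≤ k → 2 ^ j ∣ n → j ≤ maxPow2 n k
maxPow2-maximal n {j} zero    j≤0   2^j∣n = j≤0
maxPow2-maximal n {j} (suc k) j≤1+k 2^j∣n with 2 ^ suc k ∣? n | ℕ.m≤n⇒m<n∨m≡n j≤1+k
... | yes _  | _              = j≤1+k
... | no _   | inj₁ (s≤s j≤k) = maxPow2-maximal n k j≤k 2^j∣n
... | no ∤n  | inj₂ ≡.refl    = contradiction 2^j∣n ∤n

v₂-maximal : ∀ n .{{_ : NonZero n}} {j} → 2 ^ j ∣ n → j ≤ v₂ n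
v₂-maximal n {j} 2^j∣n = maxPow2-maximal n n
  (ℕ.<⇒≤ (ℕ.<-≤-trans (n<m^n ℕ.≤-refl j) (∣⇒≤ 2^j∣n))) 2^j∣n

infix 4 2^_∥_
-- The odd cofactor is stored as `suc (2 * half)`, which turns statements about exact powers of 2
-- into polynomial identities.
record 2^_∥_ (s n : ℕ) : Set where
  constructor _,_
  field
    half     : ℕ
    equality : n ≡ 2 ^ s * suc (2 * half)

even⊎odd : ∀ n → ∃[ k ] (n ≡ 2 * k ⊎ n ≡ suc (2 * k))
even⊎odd zero = 0 , inj₁ ≡.refl
even⊎odd (suc n) with even⊎odd n
... | k , inj₁ even = k , inj₂ (≡.cong suc even)
... | k , inj₂ odd  = suc k , inj₁ (≡.trans (≡.cong suc odd) (≡.sym (ℕ.*-suc 2 k)))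

-- An even cofactor would let one more factor 2 divide n, contradicting maximality of `v₂ n`.
2^v₂∥ : ∀ n .{{_ : NonZero n}} → 2^ v₂ n ∥ n
2^v₂∥ n with divides m n≡ ← maxPow2-∣ n n with even⊎odd m
... | k , inj₂ m-odd  = k ,
  ≡.trans n≡ (≡.trans (ℕ.*-comm m _) (≡.cong (2 ^ v₂ n *_) m-odd))
... | k , inj₁ m-even = contradiction (v₂-maximal n (divides k n≡k*2^)) ℕ.1+n≰n
  where
  rearrange : ∀ A k → 2 * k * A ≡ k * (2 * A)
  rearrange = solve-∀
  n≡k*2^ : n ≡ k * 2 ^ suc (v₂ n)
  n≡k*2^ = ≡.trans n≡ (≡.trans (≡.cong (_* 2 ^ v₂ n) m-even) (rearrange (2 ^ v₂ n) k))

-- If s were below `v₂ n`, cancelling `2 ^ s` would leave 2 dividing the odd cofactor.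
2^∥⇒v₂≡ : ∀ n .{{_ : NonZero n}} {s} → 2^ s ∥ n → v₂ n ≡ s
2^∥⇒v₂≡ n {s} (k , n≡) with ℕ.m≤n⇒m<n∨m≡n
  (v₂-maximal n (≡.subst (2 ^ s ∣_) (≡.sym n≡) (m∣m*n (suc (2 * k)))))
... | inj₂ s≡v = ≡.sym s≡v
... | inj₁ s<v = contradiction odd≡even (ℕ.even≢odd m k ∘ ≡.sym)
  where
  2∣odd : 2 ∣ suc (2 * k)
  2∣odd = *-cancelˡ-∣ (2 ^ s) {{ℕ.m^n≢0 2 s}} (≡.subst₂ _∣_ (ℕ.*-comm 2 (2 ^ s)) n≡
    (∣-trans 2^1+s∣2^v (maxPow2-∣ n n)))
    where
    2^1+s∣2^v : 2 ^ suc s ∣ 2 ^ v₂ n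
    2^1+s∣2^v = ≡.subst (λ e → 2 ^ suc s ∣ 2 ^ e) (ℕ.m+[n∸m]≡n s<v)
      (≡.subst (2 ^ suc s ∣_) (≡.sym (ℕ.^-distribˡ-+-* 2 (suc s) (v₂ n ∸ suc s)))
        (m∣m*n (2 ^ (v₂ n ∸ suc s))))
  m = _∣_.quotient 2∣odd
  odd≡even : suc (2 * k) ≡ 2 * m
  odd≡even = ≡.trans (_∣_.equality 2∣odd) (ℕ.*-comm m 2)

2^∥-* : ∀ {s t m n} → 2^ s ∥ m → 2^ t ∥ n → 2^ (s + t) ∥ m * n
2^∥-* {s} {t} {m} {n} (j , m≡) (k , n≡) = j + k + 2 * j * k ,
  ≡.trans (≡.cong₂ _*_ m≡ n≡) (≡.trans (expand (2 ^ s) (2 ^ t) j k)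
    (≡.cong (_* suc (2 * (j + k + 2 * j * k))) (≡.sym (ℕ.^-distribˡ-+-* 2 s t))))
  where
  expand : ∀ A B j k → A * (1 + 2 * j) * (B * (1 + 2 * k)) ≡
                       A * B * (1 + 2 * (j + k + 2 * j * k))
  expand = solve-∀

-- Subtraction-free form of 2^ s ∥ n ∸ 1.
infix 4 2^_∥pred_
record 2^_∥pred_ (s n : ℕ) : Set where
  constructor _,_
  field
    half     : ℕ
    equality : n ≡ suc (2 ^ s * suc (2 * half))

-- n² - 1 = (n - 1)(n + 1), and n is 1 modulo 4, so n + 1 contributes exactly one factor 2. With u =
-- 1 + 2k the new odd cofactor is u + 2 · 2^s · u².
∥pred-square : ∀ s {n} → 2^ suc (suc s) ∥pred n → 2^ suc (suc (suc s)) ∥pred n * n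
∥pred-square s (k , ≡.refl) = k + 2 ^ s * (suc (2 * k) * suc (2 * k)) , expand (2 ^ s) k
  where
  expand : ∀ A k → (1 + 2 * (2 * A) * (1 + 2 * k)) * (1 + 2 * (2 * A) * (1 + 2 * k)) ≡
    1 + 2 * (2 * (2 * A)) * (1 + 2 * (k + A * ((1 + 2 * k) * (1 + 2 * k))))
  expand = solve-∀

∥pred-^2^ : ∀ s {n} → 2^ suc (suc s) ∥pred n → ∀ j → 2^ suc (suc (j + s)) ∥pred n ^ (2 ^ j)
∥pred-^2^ s {n} h zero = ≡.subst (2^ _ ∥pred_) (≡.sym (ℕ.*-identityʳ n)) h
∥pred-^2^ s {n} h (suc j) = ≡.subst (2^ suc (suc (suc j + s)) ∥pred_) (square n j)
  (∥pred-square (j + s) (∥pred-^2^ s h j))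
  where
  square : ∀ n j → n ^ (2 ^ j) * n ^ (2 ^ j) ≡ n ^ (2 ^ suc j)
  square n j = ≡.trans (≡.sym (ℕ.^-distribˡ-+-* n (2 ^ j) (2 ^ j)))
    (≡.cong (λ e → n ^ (2 ^ j + e)) (≡.sym (ℕ.+-identityʳ (2 ^ j))))

-- The exponent grows by two at a time. As n² is 1 modulo 2^(s+2), multiplying by it cannot change
-- the exact power 2^(s+1).
∥pred-^odd : ∀ s {n} → 2^ suc s ∥pred n → ∀ m → 2^ suc s ∥pred n ^ suc (2 * m)
∥pred-^odd s {n} h zero = ≡.subst (2^ _ ∥pred_) (≡.sym (ℕ.*-identityʳ n)) h
∥pred-^odd s {n} h@(k , n≡) (suc m) with k′ , eq ← ∥pred-^odd s h m =
  k′ + w + 2 * 2 ^ s * w * suc (2 * k′) ,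
  ≡.trans (≡.cong (λ e → n * (n ^ e)) (ℕ.*-suc 2 m))
  (≡.trans (reassoc n (n ^ (2 * m)))
  (≡.trans (≡.cong₂ (λ x y → x * (y * y)) eq n≡) (expand (2 ^ s) k k′)))
  where
  -- Chosen so that n² = 1 + 4 · 2^s · w; the product then changes the odd cofactor by an even
  -- amount.
  w = suc (2 * k) + 2 ^ s * (suc (2 * k) * suc (2 * k))
  reassoc : ∀ n x → n * (n * (n * x)) ≡ n * x * (n * n)
  reassoc = solve-∀
  expand : ∀ A k k′ →
    (1 + 2 * A * (1 + 2 * k′)) *
      ((1 + 2 * A * (1 + 2 * k)) * (1 + 2 * A * (1 + 2 * k))) ≡
    1 + 2 * A * (1 + 2 * (k′ + ((1 + 2 * k) + A * ((1 + 2 * k) * (1 + 2 * k)))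
        + 2 * A * ((1 + 2 * k) + A * ((1 + 2 * k) * (1 + 2 * k))) * (1 + 2 * k′)))
  expand = solve-∀

-- Exact power of 2 in p^n - 1 for an odd base p

module _ {p : ℕ} (p>1 : 1 < p) (p-odd : ¬ 2 ∣ p) where

  private instance
    p≢0 : NonZero p
    p≢0 = >-nonZero (ℕ.<⇒≤ p>1)
    p∸1≢0 : NonZero (p ∸ 1)
    p∸1≢0 = >-nonZero (ℕ.m<n⇒0<n∸m p>1)
    p+1≢0 : NonZero (p + 1)
    p+1≢0 = >-nonZero (ℕ.m≤n⇒m≤o+n p ℕ.≤-refl)

  ∥pred-v₂ : 2^ v₂ (p ∸ 1) ∥pred p
  ∥pred-v₂ with k , eq ← 2^v₂∥ (p ∸ 1) =
    k , ≡.trans (≡.sym (ℕ.m+[n∸m]≡n (ℕ.<⇒≤ p>1))) (≡.cong suc eq)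

  0<v₂[p∸1] : 0 < v₂ (p ∸ 1)
  0<v₂[p∸1] with v₂ (p ∸ 1) | ∥pred-v₂
  ... | suc _ | _      = z<s
  ... | zero  | k , p≡ = contradiction
    (≡.subst (2 ∣_) (≡.sym (≡.trans p≡ (even k))) (m∣m*n (1 + k))) p-odd
    where
    even : ∀ k → 1 + 1 * (1 + 2 * k) ≡ 2 * (1 + k)
    even = solve-∀

  -- One of p ∸ 1 and p + 1 is exactly divisible by 2.
  v₂[p∸1]+v₂[p+1] : v₂ (p ∸ 1) + v₂ (p + 1) ≡ suc (v₂ (p ∸ 1) ⊔ v₂ (p + 1))
  v₂[p∸1]+v₂[p+1] with v₂ (p ∸ 1) | ∥pred-v₂ | 0<v₂[p∸1]
  ... | suc zero | k , p≡ | _ = ≡.cong suc (≡.sym (ℕ.m≤n⇒m⊔n≡n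
    (ℕ.<⇒≤ (v₂-maximal (p + 1) {2}
      (≡.subst (4 ∣_) (≡.sym (≡.trans (≡.cong (_+ 1) p≡) (div4 k))) (m∣m*n (1 + k)))))))
    where
    div4 : ∀ k → 1 + 2 * (1 + 2 * k) + 1 ≡ 4 * (1 + k)
    div4 = solve-∀
  ... | suc (suc l) | k , p≡ | _ =
    ≡.trans (≡.cong (suc (suc l) +_) v₂[p+1]≡1) (≡.trans (ℕ.+-comm _ 1)
      (≡.cong suc (≡.sym (ℕ.m≥n⇒m⊔n≡m
        (≡.subst (_≤ suc (suc l)) (≡.sym v₂[p+1]≡1) (s≤s z≤n))))))
    where
    half : ∀ A k → 1 + 2 * (2 * A) * (1 + 2 * k) + 1 ≡ 2 * (1 + 2 * (A * (1 + 2 * k)))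
    half = solve-∀
    v₂[p+1]≡1 : v₂ (p + 1) ≡ 1
    v₂[p+1]≡1 = 2^∥⇒v₂≡ (p + 1)
      (2 ^ l * suc (2 * k) , ≡.trans (≡.cong (_+ 1) p≡) (half (2 ^ l) k))

  -- p² - 1 = (p - 1)(p + 1), and the valuations of the two factors add up to one more than their
  -- maximum.
  ∥pred-p*p : 2^ suc (v₂ (p ∸ 1) ⊔ v₂ (p + 1)) ∥pred p * p
  ∥pred-p*p = let k , eq = 2^∥-* (2^v₂∥ (p ∸ 1)) (2^v₂∥ (p + 1)) in
    k , ≡.trans (≡.cong (λ x → x * x) (≡.sym 1+[p∸1]≡p))
        (≡.trans (difference-of-squares (p ∸ 1))
        (≡.cong suc (≡.trans (≡.cong (λ x → (p ∸ 1) * (x + 1)) 1+[p∸1]≡p)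
        (≡.trans eq (≡.cong (λ e → 2 ^ e * suc (2 * k)) v₂[p∸1]+v₂[p+1])))))
    where
    1+[p∸1]≡p : 1 + (p ∸ 1) ≡ p
    1+[p∸1]≡p = ℕ.m+[n∸m]≡n (ℕ.<⇒≤ p>1)
    difference-of-squares : ∀ d → (1 + d) * (1 + d) ≡ 1 + d * (1 + d + 1)
    difference-of-squares = solve-∀

  ∥pred-p^odd : ∀ n .{{_ : NonZero n}} → v₂ n ≡ 0 → 2^ v₂ (p ∸ 1) ∥pred p ^ n
  ∥pred-p^odd n v≡0 with v₂ (p ∸ 1) | ∥pred-v₂ | 0<v₂[p∸1] | v₂ n | 2^v₂∥ n
  ∥pred-p^odd n ≡.refl | suc s | h | _ | _ | k , n≡ =
    ≡.subst (λ n → 2^ suc s ∥pred p ^ n) (≡.sym (≡.trans n≡ (ℕ.*-identityˡ _)))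
      (∥pred-^odd s h k)

  -- Write p^n as an odd power of (p²)^(2^(ν-1)). The exponent for p² is one more than the maximum,
  -- each of the ν - 1 further squarings adds one, and the odd power adds nothing.
  ∥pred-p^even : ∀ n .{{_ : NonZero n}} {ν} → 1 ≤ ν → v₂ n ≡ ν →
                 2^ (v₂ (p ∸ 1) ⊔ v₂ (p + 1) + ν) ∥pred p ^ n
  ∥pred-p^even n {suc ν} _ v≡
    with v₂ (p ∸ 1) ⊔ v₂ (p + 1) | ∥pred-p*p
       | ℕ.<-≤-trans 0<v₂[p∸1] (ℕ.m≤m⊔n _ (v₂ (p + 1))) | v₂ n | 2^v₂∥ n
  -- Here `μ` is the maximum less one and `ν` the valuation of n less one; `h` then has exponent
  -- `suc (suc μ)`, the form that `∥pred-^2^` asks for.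
  ∥pred-p^even n {suc ν} _ ≡.refl | suc μ | h | _ | _ | k , n≡ =
    ≡.subst₂ (2^_∥pred_) (exponent μ ν) power
      (∥pred-^odd (suc (ν + μ)) (∥pred-^2^ μ h ν) k)
    where
    exponent : ∀ μ ν → 2 + (ν + μ) ≡ 1 + μ + (1 + ν)
    exponent = solve-∀
    power : ((p * p) ^ (2 ^ ν)) ^ suc (2 * k) ≡ p ^ n
    power = ≡.trans (≡.cong (λ x → (x ^ (2 ^ ν)) ^ suc (2 * k))
                      (≡.cong (p *_) (≡.sym (ℕ.*-identityʳ p))))
      (≡.trans (≡.cong (_^ suc (2 * k)) (ℕ.^-*-assoc p 2 (2 ^ ν)))
      (≡.trans (ℕ.^-*-assoc p (2 ^ suc ν) (suc (2 * k))) (≡.cong (p ^_) (≡.sym n≡))))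

-- Limits

open import Data.Integer.Base as ℤ using (+_; -[1+_])

-- The difference is (A - 1)/(Aq), which is less than 1/q. As q exceeds the denominator of ε, 1/q
-- lies below ε.
∣[1+t]/[1+At]-1/A∣<ε : ∀ A t m q .{{_ : NonZero A}} .{{_ : NonZero q}} →
  m ≡ suc t → q ≡ suc (A * t) →
  ∀ ε → 0ℚ ℚ.< ε → ↧ₙ ε < q → ℚ.∣ (+ m) ℚ./ q ℚ.- (+ 1) ℚ./ A ∣ ℚ.< ε
∣[1+t]/[1+At]-1/A∣<ε A t m q _ _ (mkℚ (+ 0) _ _) (ℚ.*<* (ℤ.+<+ ())) _
∣[1+t]/[1+At]-1/A∣<ε A t m q _ _ (mkℚ -[1+ _ ] _ _) (ℚ.*<* ()) _
∣[1+t]/[1+At]-1/A∣<ε (suc w) t _ _ ≡.refl ≡.refl ε@(mkℚ (+ suc e) d-1 _) _ d<q =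
  ℚ.toℚᵘ-cancel-< (ℚᵘ.<-respˡ-≃ (ℚᵘ.≃-sym toℚᵘ-distance) (*<* (≡.subst (ℤ._< _)
    (≡.cong (λ z → + ℤ.∣ z ∣ ℤ.* + suc d-1) (≡.sym numerator)) (≡.subst₂ ℤ._<_
      (ℤ.pos-* w (suc d-1)) (ℤ.pos-* (suc e) (Q * A)) (ℤ.+<+ w*d<e*Q*A)))))
  where
  open ℚᵘ.≤-Reasoning
  A = suc w
  Q = suc (A * t)
  X = mkℚᵘ (+ suc t) (A * t)
  Y = mkℚᵘ (+ 1) w

  toℚᵘ-distance : ℚ.toℚᵘ (ℚ.∣ (+ suc t) ℚ./ Q ℚ.- (+ 1) ℚ./ A ∣) ≃ ℚᵘ.∣ X ℚᵘ.- Y ∣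
  toℚᵘ-distance = begin-equality
    ℚ.toℚᵘ (ℚ.∣ x ℚ.- y ∣)             ≃⟨ ℚ.toℚᵘ-homo-∣-∣ (x ℚ.- y) ⟩
    ℚᵘ.∣ ℚ.toℚᵘ (x ℚ.- y) ∣            ≃⟨ ℚᵘ.∣-∣-cong (ℚ.toℚᵘ-homo-+ x (ℚ.- y)) ⟩
    ℚᵘ.∣ ℚ.toℚᵘ x ℚᵘ.+ ℚ.toℚᵘ (ℚ.- y) ∣ ≃⟨ ℚᵘ.∣-∣-cong (ℚᵘ.+-cong (ℚ.toℚᵘ-fromℚᵘ X)
      (ℚᵘ.≃-trans (ℚ.toℚᵘ-homo‿- y) (ℚᵘ.-‿cong (ℚ.toℚᵘ-fromℚᵘ Y)))) ⟩
    ℚᵘ.∣ X ℚᵘ.- Y ∣                    ∎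
    where
    x = (+ suc t) ℚ./ Q
    y = (+ 1) ℚ./ A

  -- (1 + t)A - (1 + At) = A - 1, which is `w`.
  numerator : + suc t ℤ.* + A ℤ.+ (ℤ.- (+ 1)) ℤ.* + Q ≡ + w
  numerator = ≡.trans (≡.cong₂ ℤ._+_ (≡.sym (ℤ.pos-* (suc t) A)) (ℤ.-1*i≡-i (+ Q)))
    (≡.trans (≡.cong (λ n → + n ℤ.+ ℤ.- (+ Q)) (expand w t))
    (≡.trans (≡.cong (ℤ._- + Q) (ℤ.pos-+ w Q))
    (≡.trans (ℤ.+-assoc (+ w) (+ Q) (ℤ.- (+ Q)))
    (≡.trans (≡.cong (λ i → + w ℤ.+ i) (ℤ.+-inverseʳ (+ Q))) (ℤ.+-identityʳ (+ w))))))
    where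
    expand : ∀ w t → (1 + t) * (1 + w) ≡ w + (1 + (1 + w) * t)
    expand = solve-∀

  w*d<e*Q*A : w * suc d-1 < suc e * (Q * A)
  w*d<e*Q*A = ℕ.<-≤-trans (ℕ.≤-<-trans (ℕ.*-monoˡ-≤ (suc d-1) (ℕ.n≤1+n w))
      (ℕ.*-monoʳ-< A d<q))
    (ℕ.≤-trans (ℕ.≤-reflexive (ℕ.*-comm A Q)) (ℕ.m≤m+n (Q * A) (e * (Q * A))))

module _ {c ℓ : Level} {p : ℕ} (p>1 : 1 < p)
         (𝔽 : ∀ (n : ℕ) → .{{_ : NonZero n}} → FiniteField c ℓ (p ^ n)) where

  -- The denominator of ε serves as the threshold, since n < p^n. Positivity of s makes p^n odd, as
  -- `OddField` requires.
  periodicProportion-limit : ∀ s → 0 < s → (P : ℕ → Set) →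
    (∀ n → .{{_ : NonZero n}} → P n → 2^ s ∥pred p ^ n) →
    LimitAlong P (λ n → periodicProportion (𝔽 n) z²) (1/2^ s)
  periodicProportion-limit (suc s) _ P exact ε 0<ε = ↧ₙ ε , λ n N≤n pn →
    let open FiniteField (𝔽 n) using (toFin; 0#)
        k , q≡ = exact n pn
        q-odd  = ≡.trans q≡ (≡.cong suc (ℕ.*-assoc 2 (2 ^ s) (suc (2 * k))))
    in
    ∣[1+t]/[1+At]-1/A∣<ε (2 ^ suc s) (suc (2 * k)) (#Per (𝔽 n) z²) (p ^ n)
      {{ℕ.m^n≢0 2 (suc s)}} {{Fin.nonZeroIndex (toFin 0#)}}
      (OddField.#Per-z² (𝔽 n) {2 ^ s * suc (2 * k)} q-odd (suc s) k q≡) q≡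
      ε 0<ε (ℕ.≤-<-trans N≤n (n<m^n p>1 n))

theorem4p4 : ∀ {c ℓ : Level} (p : ℕ) → Prime p → ¬ (2 ∣ p) →
  (𝔽 : ∀ (n : ℕ) → .{{_ : NonZero n}} → FiniteField c ℓ (p ^ n)) →
  ∀ (lam μ : ℕ) → v₂ (p ∸ 1) ≡ lam → v₂ (p ∸ 1) ⊔ v₂ (p + 1) ≡ μ →
  LimitAlong (λ n → v₂ n ≡ 0) (λ n → periodicProportion (𝔽 n) z²) (1/2^ lam)
  × (∀ (ν : ℕ) → 1 ≤ ν →
     LimitAlong (λ n → v₂ n ≡ ν) (λ n → periodicProportion (𝔽 n) z²) (1/2^ (μ + ν)))
theorem4p4 p p-prime 2∤p 𝔽 _ _ ≡.refl ≡.refl =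
  periodicProportion-limit p>1 𝔽 _ 0<λ _ (λ n → ∥pred-p^odd p>1 2∤p n) ,
  λ ν 1≤ν → periodicProportion-limit p>1 𝔽 _ (ℕ.m≤n⇒m≤o+n _ 1≤ν) _
    (λ n → ∥pred-p^even p>1 2∤p n 1≤ν)
  where
  p>1 : 1 < p
  p>1 = nonTrivial⇒n>1 p {{prime⇒nonTrivial p-prime}}
  0<λ : 0 < v₂ (p ∸ 1)
  0<λ = 0<v₂[p∸1] p>1 2∤p
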